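{- Every valid entailment in the Tamari order has exactly one focused derivation: for all formulas $A$ and $B$ with $A \le B$ in the Tamari order, there is exactly one focused derivation of the sequent $A \longrightarrow B$.
   Context: Fix a set of atoms. Formulas are generated by: every atom $p$ is a formula, and if $A,B$ are formulas then $A*B$ is a (compound) formula. The Tamari order $\le$ is the least reflexive and transitive relation on formulas such that $(A*B)*C \le A*(B*C)$ for all $A,B,C$, and such that $A \le A'$ implies $A*B \le A'*B$ and $B \le B'$ implies $A*B \le A*B'$. A context is a possibly empty finite list of formulas; comma denotes concatenation. A sequent $\Gamma \longrightarrow A$ is a pair of a context $\Gamma$ and a formula $A$. A context is irreducible if its leftmost formula is not compound, and we write $\Gamma^{\mathrm{irr}}$ for an irreducible context. A focused derivation is a closed derivation (a finite tree of rule instances, with internal nodes labelled by rule names and edges labelled by sequents, and no undischarged premises) constructed using only the rules: - $*L$: from $A,B,\Delta \longrightarrow C$ infer $A*B,\Delta \longrightarrow C$; - $*R^{\mathrm{foc}}$: from $\Gamma^{\mathrm{irr}} \longrightarrow A$ and $\Delta \longrightarrow B$ infer $\Gamma^{\mathrm{irr}},\Delta \longrightarrow A*B$, where $\Gamma^{\mathrm{irr}}$ is irreducible; - $id^{\mathrm{atm}}$: infer $p \longrightarrow p$, where $p$ is an atom. A focused derivation of a sequent is one whose conclusion is that sequent. -}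

module Defs where

open import Data.List using (List; []; _∷_; _++_; [_])

data Formula (Atom : Set) : Set where
  atom : Atom → Formula Atom
  _*_  : Formula Atom → Formula Atom → Formula Atom

infix 4 _≤_ _⟶_
infixl 7 _*_

data _≤_ {Atom : Set} : Formula Atom → Formula Atom → Set where
  ≤-refl  : ∀ {A} → A ≤ A
  ≤-trans : ∀ {A B C} → A ≤ B → B ≤ C → A ≤ C
  ≤-assoc : ∀ {A B C} → (A * B) * C ≤ A * (B * C)
  ≤-monoˡ : ∀ {A A′ B} → A ≤ A′ → A * B ≤ A′ * B
  ≤-monoʳ : ∀ {A B B′} → B ≤ B′ → A * B ≤ A * B′

Context : Set → Set
Context Atom = List (Formula Atom)

-- The empty context has no leftmost formula, so it is vacuously irreducible.
-- Each context has at most one proof of irreducibility, so storing that proof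
-- in a derivation does not create distinct derivations with the same tree.
data Irreducible {Atom : Set} : Context Atom → Set where
  empty      : Irreducible []
  atom-first : ∀ {p Γ} → Irreducible (atom p ∷ Γ)

-- Γ ⟶ A is the type of focused derivations of that sequent: its elements are
-- the derivation trees, and _≡_ between them is equality of trees.
data _⟶_ {Atom : Set} : Context Atom → Formula Atom → Set where
  *L    : ∀ {A B Δ C} → A ∷ B ∷ Δ ⟶ C → A * B ∷ Δ ⟶ C
  *Rfoc : ∀ {Γ Δ A B} → Irreducible Γ → Γ ⟶ A → Δ ⟶ B → Γ ++ Δ ⟶ A * B
  idatm : ∀ {p} → [ atom p ] ⟶ atom p

{-# OPTIONS --safe #-}
module Submission where

-- Existence.  Every formula has a focused identity derivation, by induction on
-- the formula: invert the left rule and combine the two identities with an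
-- unrestricted right rule (`*R`, `identity`).  It then suffices that A ≤ A′
-- turns derivations of A′ , Δ ⟶ C into derivations of A , Δ ⟶ C
-- (`≤-replaceˡ`).  Reflexivity and transitivity are immediate, and the other
-- generators follow from invertibility of the left rule at the leftmost
-- position, provided that a replacement of a formula which is admissible at the
-- leftmost position is admissible at every position.  That is `replace`,
-- proved by induction on derivations; no cut elimination is needed.
--
-- Uniqueness.  The shape of the context decides between the left rule and the
-- right rule, so the only possible choice is how the right rule splits its
-- context.  A derivable sequent has equally many atom occurrences on both sides
-- (`leaves-balanced`), and every formula has at least one.  So in Γ , Δ ⟶ A * B
-- the part Γ is the prefix with as many leaves as A, and it is determined
-- (`++-split-unique`).

open import Data.Empty using (⊥; ⊥-elim)
open import Data.List using (List; []; _∷_; _++_; [_]; map)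
open import Data.List.Properties using (++-assoc; map-++; ∷-injective)
open import Data.Nat using (ℕ; _+_; _<_; z<s)
open import Data.Nat.ListAction using (sum)
open import Data.Nat.ListAction.Properties using (sum-++)
open import Data.Nat.Properties
  using (+-assoc; +-cancelˡ-≡; <⇒≢; <-≤-trans; m≤m+n)
open import Data.Product using (Σ-syntax; ∃-syntax; _×_; _,_)
open import Data.Sum using (_⊎_; inj₁; inj₂)
open import Relation.Binary.PropositionalEquality
  using (_≡_; refl; sym; trans; cong; cong₂; subst)
open import Defs

private
  variable
    Atom : Set
    A A′ B C : Formula Atom
    Γ Γ′ Δ Δ′ Θ : Context Atom

-- The number of atom occurrences in a formula.
leaves : Formula Atom → ℕ
leaves (atom p) = 1
leaves (A * B)  = leaves A + leaves B

-- The number of atom occurrences in a context.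
leavesᶜ : Context Atom → ℕ
leavesᶜ Γ = sum (map leaves Γ)

leaves-positive : (A : Formula Atom) → 0 < leaves A
leaves-positive (atom p) = z<s
leaves-positive (A * B)  = <-≤-trans (leaves-positive A) (m≤m+n _ _)

leavesᶜ-∷-nonzero : (A : Formula Atom) (Γ : Context Atom) →
                    0 ≡ leavesᶜ (A ∷ Γ) → ⊥
leavesᶜ-∷-nonzero A Γ = <⇒≢ (<-≤-trans (leaves-positive A) (m≤m+n _ _))

leavesᶜ-++ : (Γ Δ : Context Atom) → leavesᶜ (Γ ++ Δ) ≡ leavesᶜ Γ + leavesᶜ Δ
leavesᶜ-++ Γ Δ = trans (cong sum (map-++ leaves Γ Δ)) (sum-++ (map leaves Γ) _)

leaves-balanced : Γ ⟶ A → leavesᶜ Γ ≡ leaves A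
leaves-balanced (*L {A} {B} d)        =
  trans (+-assoc (leaves A) (leaves B) _) (leaves-balanced d)
leaves-balanced (*Rfoc {Γ} {Δ} _ d e) =
  trans (leavesᶜ-++ Γ Δ) (cong₂ _+_ (leaves-balanced d) (leaves-balanced e))
leaves-balanced idatm                 = refl

context-nonempty : [] ⟶ A → ⊥
context-nonempty {A = A} d = <⇒≢ (leaves-positive A) (leaves-balanced d)

*L-invert : A * B ∷ Δ ⟶ C → A ∷ B ∷ Δ ⟶ C
*L-invert d = go d refl
  where
  -- The context is generalised so that the right rule, whose conclusion has a
  -- concatenation as its context, can be matched.
  go : Γ ⟶ C → Γ ≡ A * B ∷ Δ → A ∷ B ∷ Δ ⟶ C
  go (*L d)                refl = d
  go (*Rfoc empty d _)     _    = ⊥-elim (context-nonempty d)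
  go (*Rfoc atom-first _ _) ()
  go idatm                 ()

-- The right rule without the irreducibility condition: the left rule is
-- inverted on the first premise until its context is irreducible.  The
-- recursion is on the leftmost formula of that context.
*R : Γ ⟶ A → Δ ⟶ B → Γ ++ Δ ⟶ A * B
*R {Γ = []}    d e = ⊥-elim (context-nonempty d)
*R {Γ = X ∷ Γ} d e = go X d e
  where
  go : ∀ X {Γ} → X ∷ Γ ⟶ A → Δ ⟶ B → X ∷ Γ ++ Δ ⟶ A * B
  go (atom p) d e = *Rfoc atom-first d e
  go (X * Y)  d e = *L (go X (*L-invert d) e)

identity : (A : Formula Atom) → [ A ] ⟶ A
identity (atom p) = idatm
identity (A * B)  = *L (*R (identity A) (identity B))

-- If Γ , Δ is also Γ′ , X , Δ′, the displayed occurrence of X is either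
-- in Γ or in Δ.
++-locate : (Γ Γ′ : Context Atom) {X : Formula Atom} →
            Γ ++ Δ ≡ Γ′ ++ X ∷ Δ′ →
            (∃[ Ξ ] (Γ ≡ Γ′ ++ X ∷ Ξ × Δ′ ≡ Ξ ++ Δ)) ⊎
            (∃[ Ξ ] (Γ′ ≡ Γ ++ Ξ × Δ ≡ Ξ ++ X ∷ Δ′))
++-locate []      Γ′       eq   = inj₂ (Γ′ , refl , eq)
++-locate (_ ∷ Γ) []       refl = inj₁ (Γ , refl , refl)
++-locate (Y ∷ Γ) (_ ∷ Γ′) eq with ∷-injective eq
... | refl , eq′ with ++-locate Γ Γ′ eq′
...   | inj₁ (Ξ , refl , q) = inj₁ (Ξ , refl , q)
...   | inj₂ (Ξ , refl , q) = inj₂ (Ξ , refl , q)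

-- A context Θ may replace the formula A when it is leftmost.
Replaceableˡ : Formula Atom → Context Atom → Set
Replaceableˡ A Θ = ∀ {Δ C} → A ∷ Δ ⟶ C → Θ ++ Δ ⟶ C

-- Replacement at the leftmost position extends to every position.  Material to
-- the left of A is decomposed first, until A is leftmost in some premise; as
-- the irreducible context of a right rule is nonempty, a replacement to the
-- right of its first formula leaves it irreducible.
replace : Replaceableˡ A Θ → (Γ : Context Atom) → Γ ++ A ∷ Δ ⟶ C → Γ ++ Θ ++ Δ ⟶ C
replace {A = A} {Θ = Θ} r Γ d = go Γ d refl
  where
  go : ∀ Γ → Γ′ ⟶ C → Γ′ ≡ Γ ++ A ∷ Δ → Γ ++ Θ ++ Δ ⟶ C
  go []          d                  refl = r d
  go (_ ∷ Γ)     (*L {X} {Y} d)     refl = *L (go (X ∷ Y ∷ Γ) d refl)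
  go (_ ∷ _)     (*Rfoc empty d _)  _    = ⊥-elim (context-nonempty d)
  go (_ ∷ Γ) (*Rfoc {A = X} {B = Y} (atom-first {p} {Γ₁}) d e) eq with ∷-injective eq
  ... | refl , eq′ with ++-locate Γ₁ Γ eq′
  ...   | inj₁ (Ξ , refl , refl) =
          subst (_⟶ X * Y)
                (cong (atom p ∷_)
                      (trans (++-assoc Γ (Θ ++ Ξ) _) (cong (Γ ++_) (++-assoc Θ Ξ _))))
                (*Rfoc atom-first (go (atom p ∷ Γ) d refl) e)
  ...   | inj₂ (Ξ , refl , refl) =
          subst (_⟶ X * Y) (cong (atom p ∷_) (sym (++-assoc Γ₁ Ξ _)))
                (*Rfoc atom-first d (go Ξ e refl))
  go (_ ∷ [])    idatm              ()
  go (_ ∷ _ ∷ _) idatm              ()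

≤-replaceˡ : A ≤ A′ → Replaceableˡ A′ [ A ]
≤-replaceˡ ≤-refl        d = d
≤-replaceˡ (≤-trans p q) d = ≤-replaceˡ p (≤-replaceˡ q d)
≤-replaceˡ (≤-assoc {A}) d = *L (*L (replace *L-invert [ A ] (*L-invert d)))
≤-replaceˡ (≤-monoˡ p)   d = *L (≤-replaceˡ p (*L-invert d))
≤-replaceˡ (≤-monoʳ {A} p) d = *L (replace (≤-replaceˡ p) [ A ] (*L-invert d))

-- A prefix of a context is determined by its number of leaves.
++-split-unique : (Γ Γ′ : Context Atom) → Γ ++ Δ ≡ Γ′ ++ Δ′ →
                  leavesᶜ Γ ≡ leavesᶜ Γ′ → Γ ≡ Γ′ × Δ ≡ Δ′
++-split-unique []      []       eq n = refl , eq
++-split-unique []      (X ∷ Γ′) eq n = ⊥-elim (leavesᶜ-∷-nonzero X Γ′ n)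
++-split-unique (X ∷ Γ) []       eq n = ⊥-elim (leavesᶜ-∷-nonzero X Γ (sym n))
++-split-unique (X ∷ Γ) (_ ∷ Γ′) eq n with ∷-injective eq
... | refl , eq′ with ++-split-unique Γ Γ′ eq′ (+-cancelˡ-≡ (leaves X) _ _ n)
...   | refl , q = refl , q

irreducible-unique : (i j : Irreducible Γ) → i ≡ j
irreducible-unique empty      empty      = refl
irreducible-unique atom-first atom-first = refl

-- The contexts are only assumed propositionally equal, so that two right rules
-- can be matched before their splits of the context are known to agree.
derivation-unique : (d : Γ ⟶ A) (d′ : Γ′ ⟶ A) (eq : Γ ≡ Γ′) →
                    subst (_⟶ A) eq d ≡ d′
derivation-unique (*L d) (*L d′) refl = cong *L (derivation-unique d d′ refl)
derivation-unique (*L _) (*Rfoc empty d′ _) _ = ⊥-elim (context-nonempty d′)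
derivation-unique (*L _) (*Rfoc atom-first _ _) ()
derivation-unique (*L _) idatm ()
derivation-unique (*Rfoc empty d _) (*L _) _ = ⊥-elim (context-nonempty d)
derivation-unique (*Rfoc atom-first _ _) (*L _) ()
derivation-unique (*Rfoc {Γ} i d e) (*Rfoc {Γ′} i′ d′ e′) eq
  with ++-split-unique Γ Γ′ eq (trans (leaves-balanced d) (sym (leaves-balanced d′)))
... | refl , refl
  with refl ← eq
     | refl ← irreducible-unique i i′
     | refl ← derivation-unique d d′ refl
     | refl ← derivation-unique e e′ refl = refl
derivation-unique idatm (*L _) ()
derivation-unique idatm idatm refl = refl

claimI3 : ∀ {Atom : Set} (A B : Formula Atom) → A ≤ B →
    Σ[ d ∈ [ A ] ⟶ B ] ((d′ : [ A ] ⟶ B) → d′ ≡ d)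
claimI3 A B A≤B = d , λ d′ → derivation-unique d′ d refl
  where
  d : [ A ] ⟶ B
  d = ≤-replaceˡ A≤B (identity B)
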